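{- Let $\leqslant$ be the natural linear ordering of $\mathbb{Z}$, let $\mathbb{Z}^+=\{z\in\mathbb{Z}: z>0\}$, and let $\mathcal{U}$ be a free ultrafilter on $\mathbb{Z}$ such that $\mathbb{Z}^+\in\mathcal{U}$. Then the following statements hold: (i) $D(\mathcal{U})\subseteq(-\mathcal{U})+\mathcal{U}$; (ii) $\mathcal{U}$ is $\mathbb{Z}$-Ramsey if and only if $D(\mathcal{U})=(-\mathcal{U})+\mathcal{U}$.
   Context: An ultrafilter is free if it is non-principal. $[\mathbb{Z}]^2$ denotes the set of $2$-element subsets of $\mathbb{Z}$, and $\mathbb{Z}$ acts on itself by translations. A free ultrafilter $\mathcal{U}$ on $\mathbb{Z}$ is $\mathbb{Z}$-Ramsey if, for every coloring $\chi:[\mathbb{Z}]^2\to\{0,1\}$ satisfying $\chi(\{g+x,g+y\})=\chi(\{x,y\})$ for all $\{x,y\}\in[\mathbb{Z}]^2$ and $g\in\mathbb{Z}$, there exists $U\in\mathcal{U}$ such that $\chi$ is constant on $[U]^2$. For $U\subseteq\mathbb{Z}$, $D(U)=\{y-x: x,y\in U,\ x<y\}$. For an ultrafilter $\mathcal{U}$ on $\mathbb{Z}$, $D(\mathcal{U})$ is the family of subsets of $\mathbb{Z}$ defined by: $V\in D(\mathcal{U})$ if and only if there exists $U\in\mathcal{U}$ with $D(U)\subseteq V$. $-\mathcal{U}=\{ -U: U\in\mathcal{U}\}$, where $-U=\{ -u:u\in U\}$. For ultrafilters $\mathcal{V},\mathcal{U}$ on $\mathbb{Z}$, the sum $\mathcal{V}+\mathcal{U}$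 is the ultrafilter on $\mathbb{Z}$ with base consisting of all sets $\bigcup_{g\in V}(g+U_g)$, where $V\in\mathcal{V}$ and $U_g\in\mathcal{U}$ for each $g\in V$; equivalently, $A\in\mathcal{V}+\mathcal{U}$ if and only if $\{g\in\mathbb{Z}: -g+A\in\mathcal{U}\}\in\mathcal{V}$. -}

module Defs where

open import Algebra.Bundles using (AbelianGroup)
open import Algebra.Properties.Group using (∙-cancelˡ)
open import Data.Bool.Base using (Bool)
open import Data.Integer.Base using (ℤ; 0ℤ; _+_; _-_; -_; _<_)
open import Data.Integer.Properties using (+-0-abelianGroup)
open import Data.Product.Base using (∃-syntax; Σ-syntax; _×_)
open import Data.Sum.Base using (_⊎_)
open import Function.Base using (_∘_)
open import Level using (Level; 0ℓ; _⊔_) renaming (suc to lsuc)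
open import Relation.Binary.PropositionalEquality.Core using (_≡_; _≢_; sym)
open import Relation.Nullary.Negation.Core using (¬_)
open import Relation.Unary using (Pred; _∈_; _∉_; _⊆_; _≐_; _∩_; ∁; ∅; U)

private
  variable
    ℓ ℓ₁ ℓ₂ : Level

Subset : Set → Set₁
Subset X = Pred X 0ℓ

-- Families built from an ultrafilter below quantify over subsets and so live one
-- universe higher, hence the free level.
Family : Set → (ℓ : Level) → Set (lsuc 0ℓ ⊔ lsuc ℓ)
Family X ℓ = Pred (Subset X) ℓ

record IsUltrafilter {X : Set} (𝒰 : Family X ℓ) : Set (lsuc 0ℓ ⊔ ℓ) where
  field
    whole    : U ∈ 𝒰
    proper   : ∅ ∉ 𝒰
    upward   : ∀ {A B} → A ⊆ B → A ∈ 𝒰 → B ∈ 𝒰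
    meet     : ∀ {A B} → A ∈ 𝒰 → B ∈ 𝒰 → (A ∩ B) ∈ 𝒰
    decisive : ∀ A → A ∈ 𝒰 ⊎ ∁ A ∈ 𝒰

IsPrincipal : {X : Set} → Family X ℓ → Set (lsuc 0ℓ ⊔ ℓ)
IsPrincipal 𝒰 = ∃[ x ] (𝒰 ≐ λ A → x ∈ A)

IsFree : {X : Set} → Family X ℓ → Set (lsuc 0ℓ ⊔ ℓ)
IsFree 𝒰 = ¬ IsPrincipal 𝒰

-- A map [X]² → {0,1}, given as a function on ordered pairs of distinct points
-- that does not depend on the order (nor on the proof of distinctness).
record Coloring (X : Set) : Set where
  field
    color   : (x y : X) → .(x ≢ y) → Bool
    unorder : ∀ x y .(x≢y : x ≢ y) → color x y x≢y ≡ color y x (x≢y ∘ sym)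

open Coloring public

ConstantOn : {X : Set} → Coloring X → Subset X → Set
ConstantOn χ A = ∃[ c ] (∀ x y → x ∈ A → y ∈ A → .(x≢y : x ≢ y) → color χ x y x≢y ≡ c)

translate-≢ : ∀ g {x y : ℤ} → x ≢ y → g + x ≢ g + y
translate-≢ g {x} {y} x≢y = x≢y ∘ ∙-cancelˡ (AbelianGroup.group +-0-abelianGroup) g x y

IsInvariant : Coloring ℤ → Set
IsInvariant χ = ∀ g x y .(x≢y : x ≢ y) →
  color χ (g + x) (g + y) (translate-≢ g x≢y) ≡ color χ x y x≢y

IsRamsey : Family ℤ ℓ → Set (lsuc 0ℓ ⊔ ℓ)
IsRamsey 𝒰 = ∀ (χ : Coloring ℤ) → IsInvariant χ → ∃[ A ] (A ∈ 𝒰 × ConstantOn χ A)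

ℤ⁺ : Subset ℤ
ℤ⁺ z = 0ℤ < z

differences : Subset ℤ → Subset ℤ
differences A z = ∃[ x ] ∃[ y ] (x ∈ A × y ∈ A × x < y × z ≡ y - x)

negate : Subset ℤ → Subset ℤ
negate A z = ∃[ a ] (a ∈ A × z ≡ - a)

translate : ℤ → Subset ℤ → Subset ℤ
translate g A z = ∃[ a ] (a ∈ A × z ≡ g + a)

D : Family ℤ ℓ → Family ℤ (lsuc 0ℓ ⊔ ℓ)
D 𝒰 V = ∃[ A ] (A ∈ 𝒰 × differences A ⊆ V)

infix  8 ⊖_
infixl 6 _⊕_

⊖_ : Family ℤ ℓ → Family ℤ (lsuc 0ℓ ⊔ ℓ)
(⊖ 𝒰) V = ∃[ A ] (A ∈ 𝒰 × V ≐ negate A)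

-- The family with base the sets ⋃_{g ∈ V} (g + W g); the values of W outside V
-- play no role.
_⊕_ : Family ℤ ℓ₁ → Family ℤ ℓ₂ → Family ℤ (lsuc 0ℓ ⊔ ℓ₁ ⊔ ℓ₂)
(𝒱 ⊕ 𝒰) A =
  Σ[ V ∈ Subset ℤ ] Σ[ W ∈ (ℤ → Subset ℤ) ]
    ( V ∈ 𝒱
    × (∀ g → g ∈ V → W g ∈ 𝒰)
    × (λ z → ∃[ g ] (g ∈ V × z ∈ translate g (W g))) ⊆ A )

{-# OPTIONS --safe #-}

-- If D(A) ⊆ V with A ∈ 𝒰, then, as every tail {y > u} lies in 𝒰, the sets -A and
-- {y ∈ A : y > u} for u ∈ A witness V ∈ (-𝒰) + 𝒰; this is (i).  A translation
-- invariant coloring of pairs is the same thing as a set of positive differences,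
-- and it is constant on [A]² exactly when D(A) lies in that set or misses it.  So,
-- (-𝒰) + 𝒰 being an ultrafilter, 𝒰 is Ramsey iff D(𝒰) is all of (-𝒰) + 𝒰.
module Submission where

open import Defs
open import Axiom.ExcludedMiddle using (ExcludedMiddle)
open import Data.Bool.Base using (Bool; true; false)
open import Data.Bool.Properties using (¬-not)
open import Data.Empty using (⊥; ⊥-elim; ⊥-elim-irr)
open import Data.Integer.Base using (ℤ; +_; -[1+_]; 0ℤ; _+_; _-_; -_; _<_; ∣_∣; -<+)
open import Data.Integer.Properties
  using ( +-comm; +-identityʳ; neg-involutive; ∣i-j∣≡∣j-i∣; 0≤i⇒+∣i∣≡i
        ; <-cmp; <-trans; <⇒≤; <⇒≢; i≤j⇒0≤j-i; i-j≡0⇒i≡j; i<j⇒suc[i]≤j; ≤∧≢⇒<)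
open import Data.Integer.Tactic.RingSolver using (solve-∀)
open import Data.Nat.Base using (zero; suc)
open import Data.Product.Base using (_×_; _,_; ∃-syntax)
open import Data.Sum.Base using (_⊎_; inj₁; inj₂; [_,_]′; map)
open import Data.Unit.Base using (⊤; tt)
open import Function.Base using (_∘_)
open import Function.Bundles using (_⇔_; mk⇔)
open import Level using (Level; 0ℓ; _⊔_; Lift; lift; lower) renaming (suc to lsuc)
open import Relation.Binary.Definitions using (tri<; tri≈; tri>)
open import Relation.Binary.PropositionalEquality
  using (_≡_; _≢_; refl; sym; trans; cong; subst)
open import Relation.Nullary.Decidable.Core using (yes; no; does; map′)
open import Relation.Nullary.Negation.Core using (contradiction)
open import Relation.Unary using (_∈_; _∉_; _⊆_; _≐_; _∩_; ∁)

open IsUltrafilter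

private
  variable
    ℓ ℓ₁ ℓ₂ : Level
    X : Set

Decisive : Family X ℓ → Set (lsuc 0ℓ ⊔ ℓ)
Decisive {X = X} 𝒰 = ∀ (A : Subset X) → A ∈ 𝒰 ⊎ ∁ A ∈ 𝒰

lower-em : ExcludedMiddle ℓ → ExcludedMiddle 0ℓ
lower-em {ℓ} em {P} = map′ lower lift (em {Lift ℓ P})

inhabited : ExcludedMiddle 0ℓ → {𝒰 : Family X ℓ} → IsUltrafilter 𝒰 →
            ∀ {A} → A ∈ 𝒰 → ∃[ x ] x ∈ A
inhabited em isU {A} A∈𝒰 with em {∃[ x ] x ∈ A}
... | yes p = p
... | no ¬p = ⊥-elim (proper isU (upward isU (λ {x} x∈A → ¬p (x , x∈A)) A∈𝒰))

free⇒cofinite : ExcludedMiddle 0ℓ → {𝒰 : Family X ℓ} → IsUltrafilter 𝒰 → IsFree 𝒰 →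
                ∀ x → (x ≢_) ∈ 𝒰
free⇒cofinite em {𝒰} isU free x with decisive isU (x ≡_)
... | inj₂ x≢∈𝒰 = x≢∈𝒰
... | inj₁ x≡∈𝒰 = ⊥-elim (free (x , members , neighbourhoods))
  where
  members : ∀ {A} → A ∈ 𝒰 → x ∈ A
  members A∈𝒰 with inhabited em isU (meet isU x≡∈𝒰 A∈𝒰)
  ... | _ , refl , x∈A = x∈A

  neighbourhoods : ∀ {A} → x ∈ A → A ∈ 𝒰
  neighbourhoods x∈A = upward isU (λ { refl → x∈A }) x≡∈𝒰

-- Induction upwards from `ℤ⁺`: beyond `+ suc n` lies the tail beyond `+ n` with the single point
-- `+ suc n` removed, and a free ultrafilter permits the removal.
tails : ExcludedMiddle 0ℓ → {𝒰 : Family ℤ ℓ} → IsUltrafilter 𝒰 → IsFree 𝒰 → ℤ⁺ ∈ 𝒰 →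
        ∀ i → (i <_) ∈ 𝒰
tails em isU free pos -[1+ n ]    = upward isU (<-trans -<+) pos
tails em isU free pos (+ zero)    = pos
tails em isU free pos (+ (suc n)) =
  upward isU (λ (n<y , sn≢y) → ≤∧≢⇒< (i<j⇒suc[i]≤j n<y) sn≢y)
    (meet isU (tails em isU free pos (+ n)) (free⇒cofinite em isU free (+ suc n)))

⊖-decisive : {𝒰 : Family ℤ ℓ} → IsUltrafilter 𝒰 → Decisive (⊖ 𝒰)
⊖-decisive {𝒰 = 𝒰} isU A = map (reflect A) (reflect (∁ A)) (decisive isU (A ∘ -_))
  where
  reflect : ∀ B → (B ∘ -_) ∈ 𝒰 → B ∈ ⊖ 𝒰
  reflect B B∈𝒰 = (B ∘ -_) , B∈𝒰
    , (λ {z} z∈B → - z , subst B (sym (neg-involutive z)) z∈B , sym (neg-involutive z))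
    , λ { (_ , a∈B , refl) → a∈B }

-- The set of `g` with `-g + A` in `𝒰`, or its complement, lies in `𝒱`. In the second case
-- decisiveness of `𝒰` puts the sections of `∁ A` at these `g` in `𝒰`.
⊕-decisive : {𝒱 : Family ℤ ℓ₁} {𝒰 : Family ℤ ℓ₂} → Decisive 𝒱 → Decisive 𝒰 → Decisive (𝒱 ⊕ 𝒰)
⊕-decisive {𝒰 = 𝒰} dec𝒱 dec𝒰 A = map
  (λ V∈𝒱 → Large , section A , V∈𝒱 , large , λ { (_ , _ , _ , a∈ , refl) → a∈ })
  (λ V∈𝒱 → ∁ Large , section (∁ A) , V∈𝒱 , small , λ { (_ , _ , _ , a∈ , refl) → a∈ })
  (dec𝒱 Large)
  where
  section : Subset ℤ → ℤ → Subset ℤ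
  section B g a = B (g + a)

  -- {g : -g + A ∈ 𝒰}, whose defining predicate lives at the level of 𝒰, is
  -- replaced by a small predicate read off the decision.
  Large : Subset ℤ
  Large g = [ (λ _ → ⊤) , (λ _ → ⊥) ]′ (dec𝒰 (section A g))

  large : ∀ g → g ∈ Large → section A g ∈ 𝒰
  large g g∈ with inj₁ A∈𝒰 ← dec𝒰 (section A g) = A∈𝒰

  small : ∀ g → g ∉ Large → section (∁ A) g ∈ 𝒰
  small g g∉ with dec𝒰 (section A g)
  ... | inj₁ _    = contradiction tt g∉
  ... | inj₂ ∁A∈𝒰 = ∁A∈𝒰

D⊆⊖⊕ : {𝒰 : Family ℤ ℓ} → IsUltrafilter 𝒰 → (∀ i → (i <_) ∈ 𝒰) → D 𝒰 ⊆ (⊖ 𝒰) ⊕ 𝒰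
D⊆⊖⊕ isU tail (A , A∈𝒰 , DA⊆V) =
  -- At `g = - u` the bound `- g` is `u`, so each sum `g + y` is a difference `y - u` with `u < y`.
  negate A , (λ g → A ∩ (- g <_))
  , (A , A∈𝒰 , (λ z∈ → z∈) , (λ z∈ → z∈))
  , (λ g _ → meet isU A∈𝒰 (tail (- g)))
  , λ { (_ , (u , u∈A , refl) , y , (y∈A , u<y) , refl) →
        DA⊆V (u , y , u∈A , y∈A , subst (_< y) (neg-involutive u) u<y , +-comm (- u) y) }

-- Pick `u` in `A` with `- u` in the index set `N`, then `y > u` in both `A` and `W (- u)`: the
-- number `y - u` lies in both sets.
⊖⊕-meets-differences :
  ExcludedMiddle 0ℓ → {𝒰 : Family ℤ ℓ} → IsUltrafilter 𝒰 → (∀ i → (i <_) ∈ 𝒰) →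
  ∀ {V A} → V ∈ (⊖ 𝒰) ⊕ 𝒰 → A ∈ 𝒰 → ∃[ z ] (z ∈ V × z ∈ differences A)
⊖⊕-meets-differences em isU tail (N , W , (B , B∈𝒰 , _ , -B⊆N) , W∈𝒰 , sum⊆V) A∈𝒰
  with u , u∈B , u∈A ← inhabited em isU (meet isU B∈𝒰 A∈𝒰)
  with -u∈N ← -B⊆N (u , u∈B , refl)
  with y , y∈W , y∈A , u<y ← inhabited em isU (meet isU (W∈𝒰 (- u) -u∈N) (meet isU A∈𝒰 (tail u)))
  = - u + y , sum⊆V (- u , -u∈N , y , y∈W , refl) , u , y , u∈A , y∈A , u<y , +-comm (- u) y

module _ (em : ExcludedMiddle 0ℓ) (V : Subset ℤ) where

  -- The absolute value makes the color independent of the order of the pair; for `x < y` it is just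
  -- `y - x`.
  distanceColoring : Coloring ℤ
  distanceColoring .color x y _   = does (em {+ ∣ y - x ∣ ∈ V})
  distanceColoring .unorder x y _ = cong (λ n → does (em {+ n ∈ V})) (∣i-j∣≡∣j-i∣ y x)

  distanceColoring-invariant : IsInvariant distanceColoring
  distanceColoring-invariant g x y _ =
    cong (λ z → does (em {+ ∣ z ∣ ∈ V})) (cancel g x y)
    where
    cancel : ∀ g x y → (g + y) - (g + x) ≡ y - x
    cancel = solve-∀

  distanceColoring-constant :
    ∀ {A} → ConstantOn distanceColoring A → differences A ⊆ V ⊎ differences A ⊆ ∁ V
  distanceColoring-constant {A} (c , const) = split c const
    where
    distance : ∀ {x y} → x < y → + ∣ y - x ∣ ≡ y - x
    distance x<y = 0≤i⇒+∣i∣≡i (i≤j⇒0≤j-i (<⇒≤ x<y))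

    split : ∀ c → (∀ x y → x ∈ A → y ∈ A → .(x ≢ y) → does (em {+ ∣ y - x ∣ ∈ V}) ≡ c) →
            differences A ⊆ V ⊎ differences A ⊆ ∁ V
    split true const = inj₁ member
      where
      member : differences A ⊆ V
      member (x , y , x∈A , y∈A , x<y , refl)
        with em {+ ∣ y - x ∣ ∈ V} | const x y x∈A y∈A (<⇒≢ x<y)
      ... | yes d∈V | _ = subst V (distance x<y) d∈V
      ... | no _    | ()
    split false const = inj₂ nonmember
      where
      nonmember : differences A ⊆ ∁ V
      nonmember (x , y , x∈A , y∈A , x<y , refl) y-x∈V
        with em {+ ∣ y - x ∣ ∈ V} | const x y x∈A y∈A (<⇒≢ x<y)
      ... | yes _  | ()
      ... | no d∉V | _ = d∉V (subst V (sym (distance x<y)) y-x∈V)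

-- A set homogeneous for `distanceColoring` has its differences inside `V` or disjoint from `V`;
-- membership of `V` in the sum excludes the latter.
ramsey⇒⊖⊕⊆D : ExcludedMiddle 0ℓ → {𝒰 : Family ℤ ℓ} → IsUltrafilter 𝒰 → (∀ i → (i <_) ∈ 𝒰) →
               IsRamsey 𝒰 → (⊖ 𝒰) ⊕ 𝒰 ⊆ D 𝒰
ramsey⇒⊖⊕⊆D em isU tail ramsey {V} V∈
  with A , A∈𝒰 , const ← ramsey (distanceColoring em V) (distanceColoring-invariant em V)
  with distanceColoring-constant em V const
... | inj₁ DA⊆V  = A , A∈𝒰 , DA⊆V
... | inj₂ DA⊆∁V with z , z∈V , z∈DA ← ⊖⊕-meets-differences em isU tail V∈ A∈𝒰
  = contradiction z∈V (DA⊆∁V z∈DA)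

module _ (χ : Coloring ℤ) (inv : IsInvariant χ) where

  -- The distances realized by color `c`, read off from pairs with one end at `0ℤ`. The point `0ℤ`
  -- belongs vacuously for either `c`, which is harmless since differences are positive.
  HasColor : Bool → Subset ℤ
  HasColor c z = .(0≢z : 0ℤ ≢ z) → color χ 0ℤ z 0≢z ≡ c

  color-cong : ∀ {x x′ y y′} → x ≡ x′ → y ≡ y′ → .(p : x ≢ y) .(q : x′ ≢ y′) →
               color χ x y p ≡ color χ x′ y′ q
  color-cong refl refl _ _ = refl

  -- Translation by `x` carries the pair of `0ℤ` and `y - x` to that of `x` and `y`, up to the
  -- equalities absorbed by `color-cong`.
  color-difference : ∀ {x y} .(x≢y : x ≢ y) .(0≢y-x : 0ℤ ≢ y - x) →
                     color χ x y x≢y ≡ color χ 0ℤ (y - x) 0≢y-x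
  color-difference {x} {y} x≢y 0≢y-x = trans
    (color-cong (sym (+-identityʳ x)) (shift x y) x≢y (translate-≢ x 0≢y-x))
    (inv x 0ℤ (y - x) 0≢y-x)
    where
    shift : ∀ x y → y ≡ x + (y - x)
    shift = solve-∀

  differences⇒constant : ∀ {A c} → differences A ⊆ HasColor c → ConstantOn χ A
  differences⇒constant {A} {c} DA⊆ = c , const
    where
    ordered : ∀ {x y} → x ∈ A → y ∈ A → x < y → .(x≢y : x ≢ y) → color χ x y x≢y ≡ c
    ordered {x} {y} x∈A y∈A x<y x≢y = trans (color-difference x≢y 0≢y-x)
      (DA⊆ (x , y , x∈A , y∈A , x<y , refl) 0≢y-x)
      where
      0≢y-x : 0ℤ ≢ y - x
      0≢y-x 0≡y-x = <⇒≢ x<y (sym (i-j≡0⇒i≡j y x (sym 0≡y-x)))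

    const : ∀ x y → x ∈ A → y ∈ A → .(x≢y : x ≢ y) → color χ x y x≢y ≡ c
    const x y x∈A y∈A x≢y with <-cmp x y
    ... | tri< x<y _ _ = ordered x∈A y∈A x<y x≢y
    ... | tri≈ _ x≡y _ = ⊥-elim-irr (x≢y x≡y)
    ... | tri> _ _ y<x = trans (unorder χ x y x≢y) (ordered y∈A x∈A y<x (x≢y ∘ sym))

  ∁-HasColor : ∁ (HasColor true) ⊆ HasColor false
  -- The color does not depend on the proof of distinctness, so being `true` for one proof would
  -- already give membership in `HasColor true`.
  ∁-HasColor ¬true 0≢z = ¬-not (λ is-true → ¬true (λ _ → is-true))

-- Decisiveness of the sum selects a color; the inclusion in `D 𝒰` then yields a set in `𝒰` all of
-- whose differences have it.
⊖⊕⊆D⇒ramsey : {𝒰 : Family ℤ ℓ} → IsUltrafilter 𝒰 → (⊖ 𝒰) ⊕ 𝒰 ⊆ D 𝒰 → IsRamsey 𝒰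
⊖⊕⊆D⇒ramsey isU sum⊆D χ inv
  with ⊕-decisive (⊖-decisive isU) (decisive isU) (HasColor χ inv true)
... | inj₁ true∈ with A , A∈𝒰 , DA⊆ ← sum⊆D true∈
  = A , A∈𝒰 , differences⇒constant χ inv DA⊆
... | inj₂ false∈ with A , A∈𝒰 , DA⊆ ← sum⊆D false∈
  = A , A∈𝒰 , differences⇒constant χ inv (λ z∈ → ∁-HasColor χ inv (DA⊆ z∈))

theorem5 : ∀ {ℓ : Level} → ExcludedMiddle ℓ →
    (𝒰 : Family ℤ ℓ) → IsUltrafilter 𝒰 → IsFree 𝒰 → ℤ⁺ ∈ 𝒰 →
    (D 𝒰 ⊆ (⊖ 𝒰) ⊕ 𝒰) × (IsRamsey 𝒰 ⇔ (D 𝒰 ≐ (⊖ 𝒰) ⊕ 𝒰))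
theorem5 em 𝒰 isU free pos =
    D⊆⊖⊕ isU tail
  , mk⇔ {B = D 𝒰 ≐ (⊖ 𝒰) ⊕ 𝒰}
        (λ ramsey → D⊆⊖⊕ isU tail , ramsey⇒⊖⊕⊆D em₀ isU tail ramsey)
        (λ (_ , sum⊆D) → ⊖⊕⊆D⇒ramsey isU sum⊆D)
  where
  em₀ : ExcludedMiddle 0ℓ
  em₀ = lower-em em

  tail : ∀ i → (i <_) ∈ 𝒰
  tail = tails em₀ isU free pos
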